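{- Let $G$ and $H$ be graphs. Then $G$ and $H$ are strongly relationally equivalent if and only if their thin graphs $G_{\mathrm{thin}}$ and $H_{\mathrm{thin}}$ are isomorphic.
   Context: Graphs are finite and undirected, with loops allowed: $G=(V_G,E_G)$ with $E_G\subseteq V_G\times V_G$ symmetric. A relation $R\subseteq X\times Y$ has full domain if every $x\in X$ is related to some $p\in Y$, and full image if every $p\in Y$ is related to by some $x\in X$. For a graph $G$, a finite set $B$ and a relation $R\subseteq V_G\times B$ with full image, $G\ast R$ is the graph with vertex set $B$ and edge set $\{(u,v)\in B\times B : \text{there is } (x,y)\in E_G \text{ with } (x,u),(y,v)\in R\}$. The equation $G\ast R=H$ means that $R\subseteq V_G\times V_H$ has full image and $G\ast R$ equals $H$ as a graph. The transpose of $R$ is $R^+=\{(u,x):(x,u)\in R\}$. Graphs $G$ and $H$ are strongly relationally equivalent if there is a relation $R\subseteq V_G\times V_H$ with full domain such that $G\ast R=H$ and $H\ast R^+=G$. Let $N_G(x)=\{z\in V_G:(x,z)\in E_G\}$. The thinness relation $S$ of $G$ is the equivalence relation on $V_G$ with $(x,y)\in S$ iff $N_G(x)=N_G(y)$. The thin graph $G_{\mathrm{thin}}$ is the quotient graph $G/S$: its vertices are the $S$-equivalence classes, and classes $\sigma,\tau$ are adjacent (possibly $\sigma=\tau$, giving a loop) iff there is $(x,y)\in E_G$ with $x\in\sigma$, $y\in\tau$. -}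

module Defs where

open import Data.Fin using (Fin)
open import Data.Fin.Properties using (all?; any?)
open import Data.Nat using (ℕ)
open import Data.Product using (Σ-syntax; ∃; ∃-syntax; _×_; _,_; proj₂)
open import Function.Base using (flip)
open import Function.Bundles using (Surjection; Bijection)
import Function.Bundles as Fun
open import Level using (0ℓ)
open import Relation.Binary
  using (DecSetoid; REL; Rel; Decidable; IsEquivalence; Symmetric; _⇔_)
import Relation.Binary.PropositionalEquality as ≡
open import Relation.Nullary.Decidable using (Dec; map′; _×-dec_; _→-dec_)
open import Relation.Unary using (Pred; _≐_)
import Relation.Unary as Unary
import Relation.Unary.Properties as Unary

-- Finite sets are setoids, so that the vertex set V/S of a quotient graph is
-- again a finite set.  A setoid with decidable equality admitting a surjection
-- from some Fin n is in bijection with some Fin m, m ≤ n; in this form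
-- finiteness passes directly to quotients by decidable equivalences.
record FiniteSet : Set₁ where
  field
    decSetoid   : DecSetoid 0ℓ 0ℓ
  open DecSetoid decSetoid public
  field
    bound       : ℕ
    enumeration : Surjection (≡.setoid (Fin bound)) setoid

  private module enum = Surjection enumeration

  ∃? : (P : Pred Carrier 0ℓ) → (∀ {x y} → x ≈ y → P x → P y) →
       Unary.Decidable P → Dec (∃ P)
  ∃? P resp P? = map′
    (λ (i , p) → enum.to i , p)
    (λ (x , p) → enum.to⁻ x , resp (sym (enum.to∘to⁻ x)) p)
    (any? (λ i → P? (enum.to i)))

  ∀? : (P : Pred Carrier 0ℓ) → (∀ {x y} → x ≈ y → P x → P y) →
       Unary.Decidable P → Dec (∀ x → P x)
  ∀? P resp P? = map′
    (λ f x → resp (enum.to∘to⁻ x) (f (enum.to⁻ x)))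
    (λ f i → f (enum.to i))
    (all? (λ i → P? (enum.to i)))

open FiniteSet using (Carrier)

-- Subsets R ⊆ X × Y.  Decidability is what makes these the subsets of a finite
-- set in the classical sense.
record Relation (X Y : FiniteSet) : Set₁ where
  private
    module X = FiniteSet X
    module Y = FiniteSet Y
  field
    rel  : REL X.Carrier Y.Carrier 0ℓ
    resp : ∀ {x x′ p p′} → x X.≈ x′ → p Y.≈ p′ → rel x p → rel x′ p′
    rel? : Decidable rel

open Relation

FullDomain : ∀ {X Y} → Relation X Y → Set
FullDomain {X} {Y} R = ∀ (x : Carrier X) → ∃[ p ] rel R x p

FullImage : ∀ {X Y} → Relation X Y → Set
FullImage {X} {Y} R = ∀ (p : Carrier Y) → ∃[ x ] rel R x p

_⁺ : ∀ {X Y} → Relation X Y → Relation Y X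
R ⁺ = record
  { rel  = flip (rel R)
  ; resp = λ u≈ x≈ → resp R x≈ u≈
  ; rel? = flip (rel? R)
  }

record GraphOn (V : FiniteSet) : Set₁ where
  field
    edges     : Relation V V
    symmetric : Symmetric (rel edges)

  E : Rel (Carrier V) 0ℓ
  E = rel edges

record Graph : Set₁ where
  field
    V       : FiniteSet
    graphOn : GraphOn V
  open GraphOn graphOn public

open Graph using (V)

-- Equality of graphs with the same vertex set is equality of the edge sets.
_≈ᴳ_ : ∀ {B} → GraphOn B → GraphOn B → Set
G ≈ᴳ H = GraphOn.E G ⇔ GraphOn.E H

module _ (G : Graph) {B : FiniteSet} (R : Relation (V G) B) where
  private
    module G = Graph G
    module V = FiniteSet G.V
    module B = FiniteSet B

  infixl 7 _∗_

  _∗_ : GraphOn B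
  _∗_ = record
    { edges = record
      { rel  = λ u v → ∃[ x ] ∃[ y ] (G.E x y × rel R x u × rel R y v)
      ; resp = λ u≈ v≈ (x , y , e , xu , yv) →
          x , y , e , resp R V.refl u≈ xu , resp R V.refl v≈ yv
      ; rel? = λ u v →
          V.∃? _ (λ x≈ (y , e , xu , yv) →
                    y , resp G.edges x≈ V.refl e , resp R x≈ B.refl xu , yv)
            (λ x → V.∃? _ (λ y≈ (e , xu , yv) →
                             resp G.edges V.refl y≈ e , xu , resp R y≈ B.refl yv)
              (λ y → rel? G.edges x y ×-dec rel? R x u ×-dec rel? R y v))
      }
    ; symmetric = λ (x , y , e , xu , yv) → y , x , G.symmetric e , yv , xu
    }

-- The equation G ∗ R = H, which includes that R has full image.
infix 4 _∗_≡ᴳ_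

_∗_≡ᴳ_ : (G : Graph) {B : FiniteSet} → Relation (V G) B → GraphOn B → Set
G ∗ R ≡ᴳ H = FullImage R × (G ∗ R) ≈ᴳ H

StronglyRelationallyEquivalent : Graph → Graph → Set₁
StronglyRelationallyEquivalent G H =
  Σ[ R ∈ Relation (V G) (V H) ]
    FullDomain R × G ∗ R ≡ᴳ Graph.graphOn H × H ∗ R ⁺ ≡ᴳ Graph.graphOn G

module _ (G : Graph) where
  private
    module G = Graph G
    module V = FiniteSet G.V

  N : V.Carrier → Pred V.Carrier 0ℓ
  N x = λ z → G.E x z

  S : Rel V.Carrier 0ℓ
  S x y = N x ≐ N y

  private
    S-isEquivalence : IsEquivalence S
    S-isEquivalence = record
      { refl  = Unary.≐-refl
      ; sym   = Unary.≐-sym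
      ; trans = Unary.≐-trans
      }
    module S = IsEquivalence S-isEquivalence

    ⊆? : ∀ x y → Dec (N x Unary.⊆ N y)
    ⊆? x y = map′ (λ f {z} → f z) (λ f z → f {z})
      (V.∀? (λ z → G.E x z → G.E y z)
        (λ z≈ f e → resp G.edges V.refl z≈ (f (resp G.edges V.refl (V.sym z≈) e)))
        (λ z → rel? G.edges x z →-dec rel? G.edges y z))

    S? : Decidable S
    S? x y = ⊆? x y ×-dec ⊆? y x

    ≈⇒S : ∀ {x y} → x V.≈ y → S x y
    ≈⇒S x≈y = resp G.edges x≈y V.refl , resp G.edges (V.sym x≈y) V.refl

    resp-S : ∀ {x x′ y} → x V.≈ x′ → S x y → S x′ y
    resp-S x≈ = S.trans (S.sym (≈⇒S x≈))

  -- An element s of this setoid stands for its class [ s ] = { x ∣ S x s };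
  -- S is the equality, so classes are compared as sets.
  V/S : FiniteSet
  V/S = record
    { decSetoid   = record
      { Carrier = V.Carrier
      ; _≈_     = S
      ; isDecEquivalence = record { isEquivalence = S-isEquivalence ; _≟_ = S? }
      }
    ; bound       = V.bound
    ; enumeration = record
      { to         = enum.to
      ; cong       = λ i≡j → ≈⇒S (enum.cong i≡j)
      ; surjective = λ x → enum.to⁻ x ,
          λ z≡ → ≈⇒S (proj₂ (enum.surjective x) z≡)
      }
    }
    where module enum = Surjection V.enumeration

  thin : Graph
  thin = record
    { V       = V/S
    ; graphOn = record
      { edges = record
        { rel  = λ s t → ∃[ x ] ∃[ y ] (S x s × S y t × G.E x y)
        ; resp = λ s≈ t≈ (x , y , xs , yt , e) →
            x , y , S.trans xs s≈ , S.trans yt t≈ , e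
        ; rel? = λ s t →
            V.∃? _ (λ x≈ (y , xs , yt , e) →
                      y , resp-S x≈ xs , yt , resp G.edges x≈ V.refl e)
              (λ x → V.∃? _ (λ y≈ (xs , yt , e) →
                               xs , resp-S y≈ yt , resp G.edges V.refl y≈ e)
                (λ y → S? x s ×-dec S? y t ×-dec rel? G.edges x y))
        }
      ; symmetric = λ (x , y , xs , yt , e) → y , x , yt , xs , G.symmetric e
      }
    }

infix 4 _≅_

_≅_ : Graph → Graph → Set
G ≅ H = Σ[ f ∈ Bijection (FiniteSet.setoid (V G)) (FiniteSet.setoid (V H)) ]
  (∀ x y → Graph.E G x y Fun.⇔ Graph.E H (Bijection.to f x) (Bijection.to f y))

{-# OPTIONS --safe #-}

-- If G ∗ R = H and H ∗ R⁺ = G, then x R u and y R v force E_G x y ⇔ E_H u v: R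
-- preserves and reflects edges.  Hence R relates S-equivalent vertices exactly
-- to S-equivalent vertices, and any choice of an R-image for each vertex is an
-- isomorphism of the thin graphs.  Conversely, the union of σ × f(σ) over the
-- S-classes σ preserves and reflects edges for every isomorphism f of the thin
-- graphs, because adjacency depends only on S-classes.
module Submission where

open import Defs
open import Data.Product using (_×_; _,_; proj₁; proj₂)
open import Function.Bundles using (_⇔_; mk⇔; Bijection; Equivalence)
open import Relation.Unary using (_⊆_)

open FiniteSet using (Carrier)
open Graph using (V; E)
open Relation using (rel)

module _ (G : Graph) where
  private
    module G = Graph G
    module V = FiniteSet G.V
    module V/S = FiniteSet (V/S G)

  ≈⇒S : ∀ {x y} → x V.≈ y → S G x y
  ≈⇒S x≈y = Relation.resp G.edges x≈y V.refl
          , Relation.resp G.edges (V.sym x≈y) V.refl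

  -- The endpoints are replaced one at a time: an inclusion of neighbourhoods moves the second
  -- vertex's partner, and symmetry turns the edge around so that the other endpoint can be moved
  -- too.
  E-resp-S : ∀ {x x′ y y′} → S G x x′ → S G y y′ → G.E x y → G.E x′ y′
  E-resp-S (x⊆ , _) (y⊆ , _) e = G.symmetric (y⊆ (G.symmetric (x⊆ e)))

  -- A thin edge only provides an edge between some representatives; by `E-resp-S` it can be carried
  -- to the given ones.
  thin-E⇔E : ∀ {x y} → E (thin G) x y ⇔ G.E x y
  thin-E⇔E {x} {y} = mk⇔
    (λ (_ , _ , xS , yS , e) → E-resp-S xS yS e)
    (λ e → x , y , V/S.refl {x} , V/S.refl {y} , e)

module _ (G H : Graph) where
  private
    module G = Graph G
    module H = Graph H
    module G/S = FiniteSet (V/S G)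
    module H/S = FiniteSet (V/S H)

  PreservesAndReflectsEdges : Relation G.V H.V → Set
  PreservesAndReflectsEdges R =
    ∀ {x y u v} → rel R x u → rel R y v → G.E x y ⇔ H.E u v

  module _ (R : Relation G.V H.V) where

    equations⇒edges : G ∗ R ≡ᴳ H.graphOn → H ∗ R ⁺ ≡ᴳ G.graphOn →
                      PreservesAndReflectsEdges R
    equations⇒edges (_ , G∗R⊆H , _) (_ , H∗R⁺⊆G , _) {x} {y} {u} {v} xu yv = mk⇔
      (λ e → G∗R⊆H (x , y , e , xu , yv))
      (λ e → H∗R⁺⊆G (u , v , e , xu , yv))

    edges⇒equations : FullDomain R → FullImage R → PreservesAndReflectsEdges R →
                      G ∗ R ≡ᴳ H.graphOn × H ∗ R ⁺ ≡ᴳ G.graphOn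
    edges⇒equations dom im edge =
      ( im
      , (λ (_ , _ , e , xu , yv) → Equivalence.to (edge xu yv) e)
      , (λ {u} {v} e → let x , xu = im u ; y , yv = im v in
           x , y , Equivalence.from (edge xu yv) e , xu , yv)) ,
      -- Full image of `R ⁺` unfolds to full domain of `R`.
      ( dom
      , (λ (_ , _ , e , xu , yv) → Equivalence.from (edge xu yv) e)
      , (λ {x} {y} e → let u , xu = dom x ; v , yv = dom y in
           u , v , Equivalence.to (edge xu yv) e , xu , yv))

    module _ (edge : PreservesAndReflectsEdges R) where

      -- A neighbour of `u` has a preimage under `R`, so its edge is pulled back to `x`, moved to
      -- `x′` and pushed forward to `u′`. Used in both directions, this makes the chosen map respect
      -- `S`.
      N-mono : FullImage R → ∀ {x x′ u u′} → rel R x u → rel R x′ u′ →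
               N G x ⊆ N G x′ → N H u ⊆ N H u′
      N-mono im xu x′u′ x⊆x′ {v} e =
        let y , yv = im v in
        Equivalence.to (edge x′u′ yv) (x⊆x′ (Equivalence.from (edge xu yv) e))

      -- The argument of `N-mono` with the roles of `G` and `H` exchanged; it yields injectivity on
      -- classes.
      N-cancel : FullDomain R → ∀ {x x′ u u′} → rel R x u → rel R x′ u′ →
                 N H u ⊆ N H u′ → N G x ⊆ N G x′
      N-cancel dom xu x′u′ u⊆u′ {y} e =
        let v , yv = dom y in
        Equivalence.from (edge x′u′ yv) (u⊆u′ (Equivalence.to (edge xu yv) e))

      thin-≅ : FullDomain R → FullImage R → thin G ≅ thin H
      thin-≅ dom im = bijection , λ x y → mk⇔
        (λ e → Equivalence.from (thin-E⇔E H)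
          (Equivalence.to (edge (image x) (image y)) (Equivalence.to (thin-E⇔E G) e)))
        (λ e → Equivalence.from (thin-E⇔E G)
          (Equivalence.from (edge (image x) (image y)) (Equivalence.to (thin-E⇔E H) e)))
        where
        f : Carrier G.V → Carrier H.V
        f x = proj₁ (dom x)

        image : ∀ x → rel R x (f x)
        image x = proj₂ (dom x)

        bijection : Bijection G/S.setoid H/S.setoid
        bijection = record
          { to        = f
          ; cong      = λ {x} {y} (x⊆y , y⊆x) →
              N-mono im (image x) (image y) x⊆y , N-mono im (image y) (image x) y⊆x
          ; bijective =
              (λ {x} {y} (x⊆y , y⊆x) →
                N-cancel dom (image x) (image y) x⊆y ,
                N-cancel dom (image y) (image x) y⊆x)
            -- The chosen image `f x` may differ from `u`; since `x` is related to both, `N-mono`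
            -- still puts them in one class.
            , (λ u → let x , xu = im u in
                x , λ {z} (z⊆x , x⊆z) →
                  N-mono im (image z) xu z⊆x , N-mono im xu (image z) x⊆z)
          }

  module _ (iso : thin G ≅ thin H) where
    private
      module f = Bijection (proj₁ iso)
      f-edge = proj₂ iso

    classRelation : Relation G.V H.V
    classRelation = record
      -- The vertex `u` lies in the class that the isomorphism assigns to the class of `x`.
      { rel  = λ x u → S H (f.to x) u
      ; resp = λ {x} {x′} {u} {u′} x≈ u≈ xu →
          H/S.trans {f.to x′} {f.to x} {u′}
            (H/S.sym {f.to x} {f.to x′} (f.cong {x} {x′} (≈⇒S G x≈)))
            (H/S.trans {f.to x} {u} {u′} xu (≈⇒S H u≈))
      ; rel? = λ x u → f.to x H/S.≟ u
      }

    classRelation-fullDomain : FullDomain classRelation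
    classRelation-fullDomain x = f.to x , H/S.refl {f.to x}

    classRelation-fullImage : FullImage classRelation
    classRelation-fullImage u =
      let x , fx≈u = f.surjective u in x , fx≈u {x} (G/S.refl {x})

    -- Edges pass through the thin graphs along `iso`, and `E-resp-S` trades `f.to x` and `f.to y`
    -- for `u` and `v`.
    classRelation-edges : PreservesAndReflectsEdges classRelation
    classRelation-edges {x} {y} {u} {v} xu yv = mk⇔
      (λ e → E-resp-S H {f.to x} {u} {f.to y} {v} xu yv
        (Equivalence.to (thin-E⇔E H)
          (Equivalence.to (f-edge x y) (Equivalence.from (thin-E⇔E G) e))))
      (λ e → Equivalence.to (thin-E⇔E G)
        (Equivalence.from (f-edge x y) (Equivalence.from (thin-E⇔E H)
          (E-resp-S H {u} {f.to x} {v} {f.to y}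
            (H/S.sym {f.to x} {u} xu) (H/S.sym {f.to y} {v} yv) e))))

theorem3p8 : (G H : Graph) →
    StronglyRelationallyEquivalent G H ⇔ (thin G ≅ thin H)
theorem3p8 G H = mk⇔
  (λ (R , dom , G∗R≡H , H∗R⁺≡G) →
    thin-≅ G H R (equations⇒edges G H R G∗R≡H H∗R⁺≡G) dom (proj₁ G∗R≡H))
  (λ iso →
    let dom = classRelation-fullDomain G H iso in
    classRelation G H iso , dom ,
    edges⇒equations G H (classRelation G H iso) dom
      (classRelation-fullImage G H iso) (classRelation-edges G H iso))
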